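{- Let $0<p<1/2$ be a constant, let $\varepsilon,\delta\in(0,1)$, and let $T$ be a tree with $n$ edges, each of which is either realized or not, accessed through a 2-sided noisy oracle with error probability $p$. Consider the following algorithm $\mathcal{A}$ (with parameters $\varepsilon,\delta,p$). Set $c=\lceil \log_{\frac{1-p}{p}}(1/\delta)\rceil$ (the threshold) and a global budget $B=\lceil \frac{1}{\varepsilon}\cdot\frac{1}{1-2p}\rceil\cdot c\cdot n$. Process the edges of $T$ one after another in a fixed order. For the current edge $e$, set a counter to $0$; while the counter is $<c$ and $B>0$: query $e$, decrease $B$ by $1$, and increase the counter by $1$ if the answer is ``Yes'' and decrease it by $1$ if the answer is ``No''. After this loop, if $B=0$, output False (``disconnected'') and stop; otherwise move to the next edge. If all edges are processed, output True (``connected''). Then: if all edges of $T$ are realized ($T$ is connected), $\mathcal{A}$ outputs True with probability at least $1-\varepsilon$; if at least one edge of $T$ is not realized ($T$ is disconnected), $\mathcal{A}$ outputs False with probability at least $1-\delta$; and $\mathcal{A}$ performs at most $O\!\left(\frac{1}{\varepsilon}\, n\log\frac{1}{\delta}\right)$ queries.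
   Context: Noisy edge-query model: each edge of a given graph is either realized or non-realized (fixed arbitrarily, possibly adversarially, in advance). An algorithm can query an oracle on an edge $e$, asking ``Is $e$ realized?'', and receives ``Yes'' or ``No''; each query costs $1$. Answers to distinct queries (including repeated queries on the same edge) are independent. In the 2-sided error regime with error probability $p<1/2$ (a constant), each answer is wrong (``No'' for a realized edge, ``Yes'' for a non-realized edge) with probability $p$ and correct with probability $1-p$. A tree is called connected if all its edges are realized and disconnected otherwise.
   Formalization: The constant in the O-bound on the number of queries may depend on p and on a bound δ₀<1 with δ≤δ₀, since a constant uniform over all δ in (0,1) is impossible: c≥1 while log(1/δ) tends to 0 as δ tends to 1. -}

module Defs where

open import Algebra.Bundles using (CommutativeRing)
import Algebra.Properties.Monoid.Mult as Multiples
import Algebra.Properties.Semiring.Exp as Powers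
open import Data.Bool.Base using (Bool; true; false; if_then_else_)
import Data.Bool.Properties as Bool
open import Data.Fin.Base using (Fin)
open import Data.Integer.Base as ℤ using (ℤ; +_; 0ℤ; 1ℤ)
import Data.Integer.Properties as ℤ
open import Data.List.Base using (List; []; _∷_)
open import Data.List.Relation.Unary.Unique.Propositional using (Unique)
open import Data.Nat.Base as ℕ using (ℕ; zero; suc; z≤n; s≤s; _⊔_)
open import Data.Product.Base using (∃; ∃₂; _×_; _,_; proj₁)
open import Data.Sum.Base using (_⊎_)
open import Level using (0ℓ) renaming (suc to lsuc)
open import Relation.Binary.Core using (Rel)
open import Relation.Binary.Structures using (IsDecTotalOrder)
import Relation.Binary.Construct.NonStrictToStrict as ToStrict
open import Relation.Binary.PropositionalEquality.Core using (_≡_)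
open import Relation.Nullary.Decidable.Core using (yes; no; does)
open import Relation.Nullary.Negation.Core using (¬_; contradiction)
open import Relation.Unary using (Pred; Satisfiable; Decidable)

-- The real numbers are axiomatised as a complete ordered field, which
-- determines them up to isomorphism.  As usual in classical
-- developments, the inverse and the supremum are total operations about
-- which nothing is assumed outside their domain.  The Archimedean
-- property follows classically from completeness; it is included so
-- that ceilings can be computed by search.

record Reals : Set (lsuc 0ℓ) where
  field
    commutativeRing : CommutativeRing 0ℓ 0ℓ

  open CommutativeRing commutativeRing public

  infix 4 _≤_ _<_
  infix 8 _⁻¹

  field
    _≤_             : Rel Carrier 0ℓ
    isDecTotalOrder : IsDecTotalOrder _≈_ _≤_
    +-monoˡ-≤       : ∀ {x y} z → x ≤ y → x + z ≤ y + z
    *-nonNegative   : ∀ {x y} → 0# ≤ x → 0# ≤ y → 0# ≤ x * y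

    _⁻¹             : Carrier → Carrier
    0≉1             : ¬ (0# ≈ 1#)
    ⁻¹-inverseʳ     : ∀ {x} → ¬ (x ≈ 0#) → x * x ⁻¹ ≈ 1#

  _<_ : Rel Carrier 0ℓ
  _<_ = ToStrict._<_ _≈_ _≤_

  open IsDecTotalOrder isDecTotalOrder public using (_≤?_)

  fromℕ : ℕ → Carrier
  fromℕ n = Multiples._×_ +-monoid n 1#

  UpperBound : Pred Carrier 0ℓ → Pred Carrier 0ℓ
  UpperBound S u = ∀ {x} → S x → x ≤ u

  field
    archimedean : ∀ x → ∃ λ n → x ≤ fromℕ n

    sup         : Pred Carrier 0ℓ → Carrier
    sup-upper   : ∀ {S} → Satisfiable S → Satisfiable (UpperBound S) →
                  UpperBound S (sup S)
    sup-least   : ∀ {S} → Satisfiable S → ∀ {u} → UpperBound S u → sup S ≤ u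

Least : Pred ℕ 0ℓ → Pred ℕ 0ℓ
Least P n = P n × (∀ {m} → P m → n ℕ.≤ m)

least : {P : Pred ℕ 0ℓ} → Decidable P → ∀ n → P n → ∃ (Least P)
least         P? zero    p = zero , p , λ _ → z≤n
least {P = P} P? (suc n) p with P? zero
... | yes p₀ = zero , p₀ , λ _ → z≤n
... | no ¬p₀ with least (λ m → P? (suc m)) n p
...   | m , pm , lb = suc m , pm , minimal _
  where
  minimal : ∀ k → P k → suc m ℕ.≤ k
  minimal zero    q = contradiction q ¬p₀
  minimal (suc _) q = s≤s (lb q)

module RealFunctions (R : Reals) where
  open Reals R
  open Powers semiring public using (_^_)

  infixl 7 _/_

  _/_ : Carrier → Carrier → Carrier
  x / y = x * y ⁻¹

  -- The logarithm of x > 0 to base b > 1: the supremum of all rationals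
  -- q = (k - l) / m, m > 0, such that b^q ≤ x, i.e. b^k ≤ b^l * x^m.
  log : Carrier → Carrier → Carrier
  log b x = sup λ y → ∃₂ λ k l → ∃ λ m′ → let m = suc m′ in
    y ≈ (fromℕ k - fromℕ l) / fromℕ m × b ^ k ≤ (b ^ l) * (x ^ m)

  -- The least natural number n ≥ x, which is the ceiling for all x > -1.
  ceiling : ∀ x → ∃ (Least λ n → x ≤ fromℕ n)
  ceiling x = let n , x≤n = archimedean x in least (λ m → x ≤? fromℕ m) n x≤n

  ⌈_⌉ : Carrier → ℕ
  ⌈ x ⌉ = proj₁ (ceiling x)

record Graph (v n : ℕ) : Set where
  field
    endpoints : Fin n → Fin v × Fin v

  Joins : Fin n → Fin v → Fin v → Set
  Joins e x y = endpoints e ≡ (x , y) ⊎ endpoints e ≡ (y , x)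

  data Walk : Fin v → Fin v → Set where
    []   : ∀ {x} → Walk x x
    step : ∀ {x y z} e → Joins e x y → Walk y z → Walk x z

  edges : ∀ {x y} → Walk x y → List (Fin n)
  edges []           = []
  edges (step e _ w) = e ∷ edges w

  -- All vertices visited except the last one.
  sources : ∀ {x y} → Walk x y → List (Fin v)
  sources []                   = []
  sources (step {x = x} _ _ w) = x ∷ sources w

  IsCycle : ∀ {x} → Walk x x → Set
  IsCycle w = ¬ (edges w ≡ []) × Unique (edges w) × Unique (sources w)

  Connected : Set
  Connected = ∀ x y → Walk x y

  Acyclic : Set
  Acyclic = ∀ {x} (w : Walk x x) → ¬ IsCycle w

-- Graph allows loops and parallel edges, but these are cycles of length
-- one and two, so an acyclic graph is simple.

record Tree (n : ℕ) : Set where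
  field
    {order}   : ℕ
    graph     : Graph order n
    nonEmpty  : 0 ℕ.< order
    connected : Graph.Connected graph
    acyclic   : Graph.Acyclic graph

  Edge : Set
  Edge = Fin n

data OracleComp (E A : Set) : Set where
  return : A → OracleComp E A
  query  : E → (Bool → OracleComp E A) → OracleComp E A

infixl 1 _>>=_

_>>=_ : ∀ {E A B} → OracleComp E A → (A → OracleComp E B) → OracleComp E B
return a  >>= f = f a
query e k >>= f = query e λ answer → k answer >>= f

-- Number of queries in the worst case over all sequences of answers.
maxQueries : ∀ {E A} → OracleComp E A → ℕ
maxQueries (return _)  = 0
maxQueries (query _ k) = suc (maxQueries (k true) ⊔ maxQueries (k false))

module NoisyOracle (R : Reals) (p : Reals.Carrier R)
                   {E : Set} (realized : E → Bool) where
  open Reals R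

  answerProbability : E → Bool → Carrier
  answerProbability e answer =
    if does (answer Bool.≟ realized e) then 1# - p else p

  -- The probability that the output is a.  Every query, including a
  -- repeated one, is answered by a fresh independent random bit, so the
  -- probabilities along a branch of the computation are multiplied.
  ℙ : OracleComp E Bool → Bool → Carrier
  ℙ (return b)  a = if does (b Bool.≟ a) then 1# else 0#
  ℙ (query e k) a = answerProbability e true  * ℙ (k true)  a +
                    answerProbability e false * ℙ (k false) a

module _ {E : Set} (c : ℕ) where

  -- The loop for a single edge, started with the given counter and
  -- budget; it returns the remaining budget.
  processEdge : E → ℤ → ℕ → OracleComp E ℕ
  processEdge e counter zero    = return zero
  processEdge e counter (suc B) with counter ℤ.<? + c
  ... | no  _ = return (suc B)
  ... | yes _ = query e λ where
    true  → processEdge e (counter ℤ.+ 1ℤ) B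
    false → processEdge e (counter ℤ.- 1ℤ) B

  processEdges : List E → ℕ → OracleComp E Bool
  processEdges []       B = return true
  processEdges (e ∷ es) B = processEdge e 0ℤ B >>= λ where
    zero       → return false
    B′@(suc _) → processEdges es B′

module Algorithm (R : Reals) (p ε δ : Reals.Carrier R) where
  open Reals R
  open RealFunctions R

  threshold : ℕ
  threshold = ⌈ log ((1# - p) / p) (1# / δ) ⌉

  budget : ℕ → ℕ
  budget n = ⌈ (1# / ε) * (1# / (1# - fromℕ 2 * p)) ⌉ ℕ.* threshold ℕ.* n

  -- The list gives the order in which the n edges are processed.
  𝒜 : ∀ {n} → List (Fin n) → OracleComp (Fin n) Bool
  𝒜 {n} es = processEdges threshold es (budget n)

{-# OPTIONS --safe #-}
module Submission where

-- Let b = (1 - p) / p, let c be the threshold and d the distance of a counter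
-- from c.  On an unrealized edge b ^ (- d) is a martingale, so the counter
-- ever reaches c with probability at most b ^ (- c) ≤ δ, and reaching c on
-- every edge is necessary for the output True.  On realized edges the counter
-- drifts towards c at speed 1 - 2 p, so that the expected number of queries is
-- at most n c / (1 - 2 p), and Markov's inequality bounds the probability of
-- exhausting the budget by ε.  The budget itself bounds the number of queries;
-- its two ceilings cost a constant factor, as log (1 / δ) ≥ log (1 / δ₀) > 0.

open import Data.Bool.Base using (Bool; true; false)
open import Data.Fin.Base using (Fin)
open import Data.List.Base using (List; []; _∷_; allFin; length)
open import Data.List.Membership.Propositional using (_∈_)
open import Data.List.Membership.Propositional.Properties using (∈-allFin)
open import Data.List.Properties using (length-tabulate)
open import Data.List.Relation.Binary.Permutation.Propositional using (_↭_; ↭-sym)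
open import Data.List.Relation.Binary.Permutation.Propositional.Properties
  using (∈-resp-↭; ↭-length)
open import Data.List.Relation.Unary.Any using (here; there)
open import Data.Integer.Base as ℤ using (ℤ; +_; 0ℤ; 1ℤ)
import Data.Integer.Properties as ℤ
open import Data.Nat.Base as ℕ using (ℕ; zero; suc; z≤n; s≤s)
import Data.Nat.Properties as ℕ
open import Data.Product.Base using (∃; _×_; _,_; proj₁; proj₂)
open import Data.Sum.Base using (inj₁; inj₂)
open import Function.Base using (_∘_)
open import Relation.Binary.Bundles using (Poset)
import Relation.Binary.Construct.NonStrictToStrict as ToStrict
open import Relation.Binary.PropositionalEquality.Core as ≡ using (_≡_)
open import Relation.Binary.Structures using (IsDecTotalOrder)
open import Relation.Nullary.Decidable.Core using (yes; no)
open import Relation.Nullary.Negation.Core using (¬_; contradiction)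
import Algebra.Properties.CommutativeSemiring.Exp as Exp
import Algebra.Properties.Ring as RingProperties
import Algebra.Properties.Semiring.Mult as Mult
import Algebra.Solver.Ring.NaturalCoefficients.Default as Solver
import Relation.Binary.Reasoning.PartialOrder as PartialOrderReasoning
open import Defs

-- Arithmetic of inequalities in an ordered field.

module OrderedField (R : Reals) where
  open Reals R hiding (zero)
  open RealFunctions R
  open IsDecTotalOrder isDecTotalOrder public
    using (isPartialOrder; antisym; total)
    renaming (refl to ≤-refl; reflexive to ≤-reflexive; trans to ≤-trans)
  open Exp commutativeSemiring public
    using (^-congˡ; ^-homo-*; ^-assocʳ; ^-distrib-*)
  open Mult semiring public using (×-homo-+; ×1-homo-*)
  open RingProperties ring public
  open Solver commutativeSemiring public
    using (solve; con; _:=_; _:+_; _:*_)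

  poset : Poset _ _ _
  poset = record { isPartialOrder = isPartialOrder }

  open PartialOrderReasoning poset public

  ≰⇒> : ∀ {x y} → ¬ (x ≤ y) → y < x
  ≰⇒> = ToStrict.≰⇒> _≈_ _≤_ sym ≤-reflexive total

  <⇒≱ : ∀ {x y} → x < y → ¬ (y ≤ x)
  <⇒≱ = ToStrict.<⇒≱ _≈_ _≤_ antisym

  <-≤-trans : ∀ {x y z} → x < y → y ≤ z → x < z
  <-≤-trans x<y y≤z = ≰⇒> λ z≤x → <⇒≱ x<y (≤-trans y≤z z≤x)

  ≤-<-trans : ∀ {x y z} → x ≤ y → y < z → x < z
  ≤-<-trans x≤y y<z = ≰⇒> λ z≤x → <⇒≱ y<z (≤-trans z≤x x≤y)

  +-monoʳ-≤ : ∀ z {x y} → x ≤ y → z + x ≤ z + y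
  +-monoʳ-≤ z {x} {y} x≤y = begin
    z + x ≈⟨ +-comm z x ⟩
    x + z ≤⟨ +-monoˡ-≤ z x≤y ⟩
    y + z ≈⟨ +-comm y z ⟩
    z + y ∎

  +-mono-≤ : ∀ {x y u v} → x ≤ y → u ≤ v → x + u ≤ y + v
  +-mono-≤ x≤y u≤v = ≤-trans (+-monoˡ-≤ _ x≤y) (+-monoʳ-≤ _ u≤v)

  x-y+y≈x : ∀ x y → x - y + y ≈ x
  x-y+y≈x x y = //-rightDividesˡ y x

  +-cancelʳ-≤ : ∀ z {x y} → x + z ≤ y + z → x ≤ y
  +-cancelʳ-≤ z {x} {y} x+z≤y+z = begin
    x         ≈⟨ //-rightDividesʳ z x ⟨
    x + z - z ≤⟨ +-monoˡ-≤ (- z) x+z≤y+z ⟩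
    y + z - z ≈⟨ //-rightDividesʳ z y ⟩
    y         ∎

  x≤y⇒0≤y-x : ∀ {x y} → x ≤ y → 0# ≤ y - x
  x≤y⇒0≤y-x {x} {y} x≤y = begin
    0#    ≈⟨ -‿inverseʳ x ⟨
    x - x ≤⟨ +-monoˡ-≤ (- x) x≤y ⟩
    y - x ∎

  0≤y-x⇒x≤y : ∀ {x y} → 0# ≤ y - x → x ≤ y
  0≤y-x⇒x≤y {x} {y} 0≤y-x = begin
    x         ≈⟨ +-identityˡ x ⟨
    0# + x    ≤⟨ +-monoˡ-≤ x 0≤y-x ⟩
    y - x + x ≈⟨ x-y+y≈x y x ⟩
    y         ∎

  *-monoˡ-≤ : ∀ {x y z} → 0# ≤ z → x ≤ y → x * z ≤ y * z
  *-monoˡ-≤ {x} {y} {z} 0≤z x≤y = 0≤y-x⇒x≤y (begin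
    0#            ≤⟨ *-nonNegative (x≤y⇒0≤y-x x≤y) 0≤z ⟩
    (y - x) * z   ≈⟨ [y-z]x≈yx-zx z y x ⟩
    y * z - x * z ∎)

  *-monoʳ-≤ : ∀ {x y z} → 0# ≤ z → x ≤ y → z * x ≤ z * y
  *-monoʳ-≤ {x} {y} {z} 0≤z x≤y = begin
    z * x ≈⟨ *-comm z x ⟩
    x * z ≤⟨ *-monoˡ-≤ 0≤z x≤y ⟩
    y * z ≈⟨ *-comm y z ⟩
    z * y ∎

  *-mono-≤ : ∀ {x y u v} → 0# ≤ x → 0# ≤ v → x ≤ y → u ≤ v → x * u ≤ y * v
  *-mono-≤ 0≤x 0≤v x≤y u≤v = ≤-trans (*-monoʳ-≤ 0≤x u≤v) (*-monoˡ-≤ 0≤v x≤y)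

  +-nonNegative : ∀ {x y} → 0# ≤ x → 0# ≤ y → 0# ≤ x + y
  +-nonNegative {x} {y} 0≤x 0≤y = begin
    0#      ≈⟨ +-identityʳ 0# ⟨
    0# + 0# ≤⟨ +-mono-≤ 0≤x 0≤y ⟩
    x + y   ∎

  x≤y+x : ∀ {x y} → 0# ≤ y → x ≤ y + x
  x≤y+x {x} {y} 0≤y = begin
    x      ≈⟨ +-identityˡ x ⟨
    0# + x ≤⟨ +-monoˡ-≤ x 0≤y ⟩
    y + x  ∎

  0≤1 : 0# ≤ 1#
  0≤1 with total 0# 1#
  ... | inj₁ 0≤1 = 0≤1
  ... | inj₂ 1≤0 = begin
    0#          ≤⟨ *-nonNegative 0≤-1 0≤-1 ⟩
    - 1# * - 1# ≈⟨ -1*x≈-x (- 1#) ⟩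
    - - 1#      ≈⟨ -‿involutive 1# ⟩
    1#          ∎
    where
    0≤-1 : 0# ≤ - 1#
    0≤-1 = ≤-trans (x≤y⇒0≤y-x 1≤0) (≤-reflexive (+-identityˡ (- 1#)))

  0<1 : 0# < 1#
  0<1 = 0≤1 , 0≉1

  <⇒≤ : ∀ {x y} → x < y → x ≤ y
  <⇒≤ = proj₁

  <⇒≉0 : ∀ {x} → 0# < x → ¬ (x ≈ 0#)
  <⇒≉0 (_ , 0≉x) x≈0 = 0≉x (sym x≈0)

  x*x⁻¹≈1 : ∀ {x} → 0# < x → x * x ⁻¹ ≈ 1#
  x*x⁻¹≈1 0<x = ⁻¹-inverseʳ (<⇒≉0 0<x)

  x/y*y≈x : ∀ {x y} → 0# < y → x / y * y ≈ x
  x/y*y≈x {x} {y} 0<y = begin-equality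
    x * y ⁻¹ * y   ≈⟨ *-assoc x (y ⁻¹) y ⟩
    x * (y ⁻¹ * y) ≈⟨ *-congˡ (trans (*-comm (y ⁻¹) y) (x*x⁻¹≈1 0<y)) ⟩
    x * 1#         ≈⟨ *-identityʳ x ⟩
    x              ∎

  ⁻¹-positive : ∀ {x} → 0# < x → 0# < x ⁻¹
  ⁻¹-positive {x} 0<x = ≰⇒> λ x⁻¹≤0 → <⇒≱ 0<1 (begin
    1#       ≈⟨ x*x⁻¹≈1 0<x ⟨
    x * x ⁻¹ ≤⟨ *-monoʳ-≤ (<⇒≤ 0<x) x⁻¹≤0 ⟩
    x * 0#   ≈⟨ zeroʳ x ⟩
    0#       ∎)

  x*y*y⁻¹≈x : ∀ {x y} → 0# < y → x * y * y ⁻¹ ≈ x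
  x*y*y⁻¹≈x {x} {y} 0<y =
    trans (*-assoc x y (y ⁻¹)) (trans (*-congˡ (x*x⁻¹≈1 0<y)) (*-identityʳ x))

  *-cancelʳ-≤ : ∀ {x y z} → 0# < z → x * z ≤ y * z → x ≤ y
  *-cancelʳ-≤ {x} {y} {z} 0<z xz≤yz = begin
    x            ≈⟨ x*y*y⁻¹≈x 0<z ⟨
    x * z * z ⁻¹ ≤⟨ *-monoˡ-≤ (<⇒≤ (⁻¹-positive 0<z)) xz≤yz ⟩
    y * z * z ⁻¹ ≈⟨ x*y*y⁻¹≈x 0<z ⟩
    y            ∎

  *-cancelˡ-≤ : ∀ {x y z} → 0# < z → z * x ≤ z * y → x ≤ y
  *-cancelˡ-≤ {x} {y} {z} 0<z zx≤zy = *-cancelʳ-≤ 0<z (begin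
    x * z ≈⟨ *-comm x z ⟩
    z * x ≤⟨ zx≤zy ⟩
    z * y ≈⟨ *-comm z y ⟩
    y * z ∎)

  *-positive : ∀ {x y} → 0# < x → 0# < y → 0# < x * y
  *-positive {x} {y} 0<x 0<y = ≰⇒> λ xy≤0 → <⇒≱ 0<x (*-cancelʳ-≤ 0<y (begin
    x * y  ≤⟨ xy≤0 ⟩
    0#     ≈⟨ zeroˡ y ⟨
    0# * y ∎))

  x≤y*z⇒x/z≤y : ∀ {x y z} → 0# < z → x ≤ y * z → x / z ≤ y
  x≤y*z⇒x/z≤y {x} {y} {z} 0<z x≤yz = *-cancelʳ-≤ 0<z (begin
    x / z * z ≈⟨ x/y*y≈x 0<z ⟩
    x         ≤⟨ x≤yz ⟩
    y * z     ∎)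

  x*z≤y⇒x≤y/z : ∀ {x y z} → 0# < z → x * z ≤ y → x ≤ y / z
  x*z≤y⇒x≤y/z {x} {y} {z} 0<z xz≤y = *-cancelʳ-≤ 0<z (begin
    x * z     ≤⟨ xz≤y ⟩
    y         ≈⟨ x/y*y≈x 0<z ⟨
    y / z * z ∎)

  -- Natural numbers inside the field.

  0≤fromℕ : ∀ n → 0# ≤ fromℕ n
  0≤fromℕ zero    = ≤-refl
  0≤fromℕ (suc n) = +-nonNegative 0≤1 (0≤fromℕ n)

  0<fromℕ : ∀ n → 0# < fromℕ (suc n)
  0<fromℕ n = <-≤-trans 0<1 (begin
    1#           ≤⟨ x≤y+x (0≤fromℕ n) ⟩
    fromℕ n + 1# ≈⟨ +-comm (fromℕ n) 1# ⟩
    1# + fromℕ n ∎)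

  fromℕ-mono-≤ : ∀ {m n} → m ℕ.≤ n → fromℕ m ≤ fromℕ n
  fromℕ-mono-≤ {n = n} z≤n = 0≤fromℕ n
  fromℕ-mono-≤ (s≤s m≤n)   = +-monoʳ-≤ 1# (fromℕ-mono-≤ m≤n)

  1<2 : 1# < fromℕ 2
  1<2 = ≰⇒> λ 2≤1 → <⇒≱ (0<fromℕ 0) (+-cancelʳ-≤ 1# (begin
    fromℕ 1 + 1# ≈⟨ +-comm (fromℕ 1) 1# ⟩
    fromℕ 2      ≤⟨ 2≤1 ⟩
    1#           ≈⟨ +-identityˡ 1# ⟨
    0# + 1#      ∎))

  1+x≰x : ∀ {x} → ¬ (1# + x ≤ x)
  1+x≰x {x} 1+x≤x = <⇒≱ 0<1 (+-cancelʳ-≤ x (begin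
    1# + x ≤⟨ 1+x≤x ⟩
    x      ≈⟨ +-identityˡ x ⟨
    0# + x ∎))

  -- Powers: monotonicity, cancellation and unbounded growth.

  0≤x^n : ∀ {x} n → 0# ≤ x → 0# ≤ x ^ n
  0≤x^n zero    0≤x = 0≤1
  0≤x^n (suc n) 0≤x = *-nonNegative 0≤x (0≤x^n n 0≤x)

  0<x^n : ∀ {x} n → 0# < x → 0# < x ^ n
  0<x^n zero    0<x = 0<1
  0<x^n (suc n) 0<x = *-positive 0<x (0<x^n n 0<x)

  ^-monoˡ-≤ : ∀ {x y} n → 0# ≤ x → x ≤ y → x ^ n ≤ y ^ n
  ^-monoˡ-≤ zero    0≤x x≤y = ≤-refl
  ^-monoˡ-≤ (suc n) 0≤x x≤y =
    *-mono-≤ 0≤x (0≤x^n n (≤-trans 0≤x x≤y)) x≤y (^-monoˡ-≤ n 0≤x x≤y)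

  1^n≈1 : ∀ n → 1# ^ n ≈ 1#
  1^n≈1 zero    = refl
  1^n≈1 (suc n) = trans (*-identityˡ _) (1^n≈1 n)

  1≤x^n : ∀ {x} n → 1# ≤ x → 1# ≤ x ^ n
  1≤x^n {x} n 1≤x = begin
    1#     ≈⟨ 1^n≈1 n ⟨
    1# ^ n ≤⟨ ^-monoˡ-≤ n 0≤1 1≤x ⟩
    x ^ n  ∎

  x≤x^1+n : ∀ {x} n → 1# ≤ x → x ≤ x ^ suc n
  x≤x^1+n {x} n 1≤x = begin
    x         ≈⟨ *-identityʳ x ⟨
    x * 1#    ≤⟨ *-monoʳ-≤ (≤-trans 0≤1 1≤x) (1≤x^n n 1≤x) ⟩
    x * x ^ n ∎

  ^-cancelʳ-≤ : ∀ {x} → 1# < x → ∀ {k l} → x ^ k ≤ x ^ l → k ℕ.≤ l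
  ^-cancelʳ-≤ {x} 1<x {k} {l} xᵏ≤xˡ with k ℕ.≤? l
  ... | yes k≤l = k≤l
  -- Otherwise `k` is `suc l + d`, and cancelling `x ^ l` leaves `x ≤ x ^ suc d ≤ 1#`.
  ... | no  k≰l with d , ≡.refl ← ℕ.m≤n⇒∃[o]m+o≡n (ℕ.≰⇒> k≰l) =
    contradiction x≤1 (<⇒≱ 1<x)
    where
    0<x = <-≤-trans 0<1 (<⇒≤ 1<x)
    x≤1 : x ≤ 1#
    x≤1 = *-cancelˡ-≤ (0<x^n l 0<x) (begin
      x ^ l * x         ≤⟨ *-monoʳ-≤ (0≤x^n l (<⇒≤ 0<x)) (x≤x^1+n d (<⇒≤ 1<x)) ⟩
      x ^ l * x ^ suc d ≈⟨ ^-homo-* x l (suc d) ⟨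
      x ^ (l ℕ.+ suc d) ≡⟨ ≡.cong (x ^_) (ℕ.+-suc l d) ⟩
      x ^ suc (l ℕ.+ d) ≤⟨ xᵏ≤xˡ ⟩
      x ^ l             ≈⟨ *-identityʳ (x ^ l) ⟨
      x ^ l * 1#        ∎)

  bernoulli : ∀ {h} → 0# ≤ h → ∀ n → fromℕ n * h ≤ (1# + h) ^ n
  bernoulli {h} 0≤h zero    = ≤-trans (≤-reflexive (zeroˡ h)) 0≤1
  bernoulli {h} 0≤h (suc n) = begin
    (1# + fromℕ n) * h              ≈⟨ distribʳ h 1# (fromℕ n) ⟩
    1# * h + fromℕ n * h            ≈⟨ +-congʳ (*-comm 1# h) ⟩
    -- The new summand `h` is absorbed by `h * (1# + h) ^ n`, since the power is at least 1.
    h * 1# + fromℕ n * h            ≤⟨ +-mono-≤ (*-monoʳ-≤ 0≤h (1≤x^n n 1≤1+h)) (bernoulli 0≤h n) ⟩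
    h * (1# + h) ^ n + (1# + h) ^ n ≈⟨ solve 2 (λ x y → x :* y :+ y := (con 1 :+ x) :* y) refl h _ ⟩
    (1# + h) * (1# + h) ^ n         ∎
    where
    1≤1+h : 1# ≤ 1# + h
    1≤1+h = ≤-trans (x≤y+x 0≤h) (≤-reflexive (+-comm h 1#))

  -- Bernoulli's inequality with `h = x - 1#` turns the Archimedean property into growth of powers.
  -- The exponent is a successor so that it can serve as a denominator in the definition of `log`.
  powers-unbounded : ∀ {x} → 1# < x → ∀ y → ∃ λ n → y ≤ x ^ suc n
  powers-unbounded {x} 1<x y with archimedean (y / (x - 1#))
  ... | n , y/h≤n = n , (begin
    y                   ≈⟨ x/y*y≈x 0<h ⟨
    y / h * h           ≤⟨ *-monoˡ-≤ (<⇒≤ 0<h) y/h≤n ⟩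
    fromℕ n * h         ≤⟨ bernoulli (<⇒≤ 0<h) n ⟩
    (1# + h) ^ n        ≈⟨ ^-congˡ n (trans (+-comm 1# h) (x-y+y≈x x 1#)) ⟩
    x ^ n               ≈⟨ *-identityˡ (x ^ n) ⟨
    1# * x ^ n          ≤⟨ *-monoˡ-≤ (0≤x^n n (≤-trans 0≤1 (<⇒≤ 1<x))) (<⇒≤ 1<x) ⟩
    x * x ^ n           ∎)
    where
    h = x - 1#
    0<h : 0# < h
    0<h = ≰⇒> λ h≤0 → <⇒≱ 1<x (begin
      x       ≈⟨ x-y+y≈x x 1# ⟨
      h + 1#  ≤⟨ +-monoˡ-≤ 1# h≤0 ⟩
      0# + 1# ≈⟨ +-identityˡ 1# ⟩
      1#      ∎)

  1<1/x : ∀ {x} → 0# < x → x < 1# → 1# < 1# / x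
  1<1/x {x} 0<x x<1 = ≰⇒> λ 1/x≤1 → <⇒≱ x<1 (begin
    1#         ≈⟨ x/y*y≈x 0<x ⟨
    1# / x * x ≤⟨ *-monoˡ-≤ (<⇒≤ 0<x) 1/x≤1 ⟩
    1# * x     ≈⟨ *-identityˡ x ⟩
    x          ∎)

  -- Ceilings.

  ⌈x⌉-upper : ∀ x → x ≤ fromℕ ⌈ x ⌉
  ⌈x⌉-upper x = proj₁ (proj₂ (ceiling x))

  ⌈x⌉-least : ∀ x {n} → x ≤ fromℕ n → ⌈ x ⌉ ℕ.≤ n
  ⌈x⌉-least x = proj₂ (proj₂ (ceiling x))

  ⌈x⌉≤1+x : ∀ {x} → 0# ≤ x → fromℕ ⌈ x ⌉ ≤ 1# + x
  ⌈x⌉≤1+x {x} 0≤x with ⌈ x ⌉ | ⌈x⌉-least x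
  ... | zero  | _     = +-nonNegative 0≤1 0≤x
  -- By minimality of `suc n`, `x ≤ fromℕ n` fails, so `fromℕ n` lies below `x`.
  ... | suc n | least = +-monoʳ-≤ 1# (<⇒≤ (≰⇒> (ℕ.<⇒≱ ℕ.≤-refl ∘ least)))

  -- The logarithm as a supremum, compared with integer powers of the base.

  module _ {b x : Carrier} (1<b : 1# < b) (1≤x : 1# ≤ x) where
    private
      0≤x = ≤-trans 0≤1 1≤x
      0<b = <-≤-trans 0<1 (<⇒≤ 1<b)

    -- Replacing `x` by `b ^ c` turns the defining inequality of a rational in the set below
    -- `log b x` into a comparison of powers of `b`, whose exponents can be compared. Thus `c` is an
    -- upper bound of that set.
    bounds-exponents : ∀ c → x ≤ b ^ c → ∀ k l m′ → let m = suc m′ in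
      b ^ k ≤ (b ^ l) * (x ^ m) → (fromℕ k - fromℕ l) / fromℕ m ≤ fromℕ c
    bounds-exponents c x≤bᶜ k l m′ bᵏ≤bˡxᵐ =
      x≤y*z⇒x/z≤y (0<fromℕ m′) (+-cancelʳ-≤ (fromℕ l) (begin
        fromℕ k - fromℕ l + fromℕ l   ≈⟨ x-y+y≈x (fromℕ k) (fromℕ l) ⟩
        fromℕ k                       ≤⟨ fromℕ-mono-≤ k≤l+cm ⟩
        fromℕ (l ℕ.+ c ℕ.* m)         ≈⟨ ×-homo-+ 1# l (c ℕ.* m) ⟩
        fromℕ l + fromℕ (c ℕ.* m)     ≈⟨ +-comm _ _ ⟩
        fromℕ (c ℕ.* m) + fromℕ l     ≈⟨ +-congʳ (×1-homo-* c m) ⟩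
        fromℕ c * fromℕ m + fromℕ l   ∎))
      where
      m = suc m′
      k≤l+cm : k ℕ.≤ l ℕ.+ c ℕ.* m
      k≤l+cm = ^-cancelʳ-≤ 1<b (begin
        b ^ k                   ≤⟨ bᵏ≤bˡxᵐ ⟩
        b ^ l * x ^ m           ≤⟨ *-monoʳ-≤ (0≤x^n l (<⇒≤ 0<b)) (^-monoˡ-≤ m 0≤x x≤bᶜ) ⟩
        b ^ l * (b ^ c) ^ m     ≈⟨ *-congˡ (^-assocʳ b c m) ⟩
        b ^ l * b ^ (c ℕ.* m)   ≈⟨ ^-homo-* b l (c ℕ.* m) ⟨
        b ^ (l ℕ.+ c ℕ.* m)     ∎)

    x≤bᶜ⇒log≤c : ∀ c → x ≤ b ^ c → log b x ≤ fromℕ c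
    x≤bᶜ⇒log≤c c x≤bᶜ = sup-least
      -- The set is inhabited by 0 = (0 - 0) / 1, because `1# ≤ x`.
      (_ , 0 , 0 , 0 , refl , (begin
        1#            ≤⟨ 1≤x ⟩
        x             ≈⟨ solve 1 (λ x → x := con 1 :* (x :* con 1)) refl x ⟩
        1# * (x * 1#) ∎))
      λ { (k , l , m′ , y≈ , bᵏ≤bˡxᵐ) →
          ≤-trans (≤-reflexive y≈) (bounds-exponents c x≤bᶜ k l m′ bᵏ≤bˡxᵐ) }

    -- The hypothesis places `k / m` in the set whose supremum is the logarithm. All lower bounds on
    -- logarithms below come from here.
    bᵏ≤xᵐ⇒k≤log*m : ∀ k m′ → let m = suc m′ in
      b ^ k ≤ x ^ m → fromℕ k ≤ log b x * fromℕ m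
    bᵏ≤xᵐ⇒k≤log*m k m′ bᵏ≤xᵐ with powers-unbounded 1<b x
    ... | N , x≤bᴺ = begin
      fromℕ k                               ≈⟨ +-identityʳ (fromℕ k) ⟨
      fromℕ k + 0#                          ≈⟨ +-congˡ -0#≈0# ⟨
      fromℕ k - 0#                          ≈⟨ x/y*y≈x (0<fromℕ m′) ⟨
      (fromℕ k - 0#) / fromℕ m * fromℕ m    ≤⟨ *-monoˡ-≤ (0≤fromℕ m) k/m≤log ⟩
      log b x * fromℕ m                     ∎
      where
      m = suc m′
      element = k , 0 , m′ , refl , ≤-trans bᵏ≤xᵐ (≤-reflexive (sym (*-identityˡ (x ^ m))))
      k/m≤log : (fromℕ k - 0#) / fromℕ m ≤ log b x
      k/m≤log = sup-upper (_ , element)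
        -- Using the supremum as an upper bound requires the set to be bounded; a power of `b` above
        -- `x` supplies the bound.
        (fromℕ (suc N) , λ { (k , l , m′ , y≈ , bᵏ≤bˡxᵐ) →
          ≤-trans (≤-reflexive y≈) (bounds-exponents (suc N) x≤bᴺ k l m′ bᵏ≤bˡxᵐ) })
        element

    -- If `x` exceeded `b ^ c`, the ratio `a = x / b ^ c` would exceed 1, so some power `a ^ m`
    -- would reach `b`. Then `b ^ (c m + 1) ≤ x ^ m`, which forces the logarithm to be at least
    -- `c + 1 / m`.
    log≤c⇒x≤bᶜ : ∀ c → log b x ≤ fromℕ c → x ≤ b ^ c
    log≤c⇒x≤bᶜ c log≤c with x ≤? b ^ c
    ... | yes x≤bᶜ = x≤bᶜ
    ... | no  x≰bᶜ with powers-unbounded 1<a b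
      where
      1<a : 1# < x / b ^ c
      1<a = ≰⇒> λ a≤1 → x≰bᶜ (begin
        x                     ≈⟨ x/y*y≈x (0<x^n c 0<b) ⟨
        x / b ^ c * b ^ c     ≤⟨ *-monoˡ-≤ (0≤x^n c (<⇒≤ 0<b)) a≤1 ⟩
        1# * b ^ c            ≈⟨ *-identityˡ (b ^ c) ⟩
        b ^ c                 ∎)
    ... | m′ , b≤aᵐ = contradiction (begin
        1# + fromℕ (c ℕ.* m)  ≤⟨ bᵏ≤xᵐ⇒k≤log*m (suc (c ℕ.* m)) m′ b*bᶜᵐ≤xᵐ ⟩
        log b x * fromℕ m     ≤⟨ *-monoˡ-≤ (0≤fromℕ m) log≤c ⟩
        fromℕ c * fromℕ m     ≈⟨ ×1-homo-* c m ⟨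
        fromℕ (c ℕ.* m)       ∎) 1+x≰x
      where
      m = suc m′
      a = x / b ^ c
      b*bᶜᵐ≤xᵐ : b ^ suc (c ℕ.* m) ≤ x ^ m
      b*bᶜᵐ≤xᵐ = begin
        b * b ^ (c ℕ.* m)     ≈⟨ *-congˡ (^-assocʳ b c m) ⟨
        b * (b ^ c) ^ m       ≤⟨ *-monoˡ-≤ (0≤x^n m (0≤x^n c (<⇒≤ 0<b))) b≤aᵐ ⟩
        a ^ m * (b ^ c) ^ m   ≈⟨ ^-distrib-* a (b ^ c) m ⟨
        (a * b ^ c) ^ m       ≈⟨ ^-congˡ m (x/y*y≈x (0<x^n c 0<b)) ⟩
        x ^ m                 ∎

-- The counter z of an edge is tracked through its distance d = c - z to
-- the threshold, so that a bound on it can be proved for natural d.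
module Counter (c : ℕ) where

  up : ∀ z d → z ℤ.+ + suc d ≡ + c → (z ℤ.+ 1ℤ) ℤ.+ + d ≡ + c
  up z d = ≡.trans (ℤ.+-assoc z 1ℤ (+ d))

  down : ∀ z d → z ℤ.+ + suc d ≡ + c → (z ℤ.- 1ℤ) ℤ.+ + suc (suc d) ≡ + c
  down z d = ≡.trans (ℤ.+-assoc z (ℤ.- 1ℤ) (+ suc (suc d)))

  z≮c : ∀ z → z ℤ.+ + 0 ≡ + c → ¬ (z ℤ.< + c)
  z≮c z z+0≡c = ℤ.<-irrefl (≡.trans (≡.sym (ℤ.+-identityʳ z)) z+0≡c)

  z<c : ∀ z d → z ℤ.+ + suc d ≡ + c → z ℤ.< + c
  z<c z d z+d≡c =
    ≡.subst₂ ℤ._<_ (ℤ.+-identityʳ z) z+d≡c (ℤ.+-monoʳ-< z (ℤ.+<+ (s≤s z≤n)))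

-- Worst-case number of queries.

module _ {E : Set} (c : ℕ) where

  -- Every query lowers the budget by one. The continuation `f`, which receives the remaining
  -- budget, lets the bound for one edge be composed with that for the later edges.
  maxQueries-processEdge : ∀ {f : ℕ → OracleComp E Bool} →
    (∀ B → maxQueries (f B) ℕ.≤ B) →
    ∀ e z B → maxQueries (processEdge c e z B >>= f) ℕ.≤ B
  maxQueries-processEdge f≤ e z zero    = f≤ zero
  maxQueries-processEdge f≤ e z (suc B) with z ℤ.<? + c
  ... | no  _ = f≤ (suc B)
  ... | yes _ = s≤s (ℕ.⊔-lub (maxQueries-processEdge f≤ e (z ℤ.+ 1ℤ) B)
                             (maxQueries-processEdge f≤ e (z ℤ.- 1ℤ) B))

  maxQueries-processEdges : ∀ (es : List E) B → maxQueries (processEdges c es B) ℕ.≤ B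
  maxQueries-processEdges []       B = z≤n
  maxQueries-processEdges (e ∷ es) B = maxQueries-processEdge
    (λ { zero → z≤n ; (suc B) → maxQueries-processEdges es (suc B) }) e 0ℤ B

module _ (R : Reals) where
  open Reals R hiding (zero)
  open RealFunctions R
  open OrderedField R

  -- Output probabilities of oracle computations.

  module OracleBounds (p : Carrier) (0≤p : 0# ≤ p) (0≤1-p : 0# ≤ 1# - p)
                      {E : Set} (realized : E → Bool) where
    open NoisyOracle R p realized

    private
      q = 1# - p

    q+p≈1 : q + p ≈ 1#
    q+p≈1 = x-y+y≈x 1# p

    0≤answerProbability : ∀ e a → 0# ≤ answerProbability e a
    0≤answerProbability e a with realized e | a
    ... | true  | true  = 0≤1-p
    ... | true  | false = 0≤p
    ... | false | true  = 0≤p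
    ... | false | false = 0≤1-p

    ∑answerProbability≈1 : ∀ e → answerProbability e true + answerProbability e false ≈ 1#
    ∑answerProbability≈1 e with realized e
    ... | true  = q+p≈1
    ... | false = trans (+-comm p q) q+p≈1

    ℙ-query-≤ : ∀ e k {a u v} → ℙ (k true) a ≤ u → ℙ (k false) a ≤ v →
      ℙ (query e k) a ≤ answerProbability e true * u + answerProbability e false * v
    ℙ-query-≤ e k ≤u ≤v = +-mono-≤ (*-monoʳ-≤ (0≤answerProbability e true) ≤u)
                                   (*-monoʳ-≤ (0≤answerProbability e false) ≤v)

    0≤ℙ : ∀ m a → 0# ≤ ℙ m a
    0≤ℙ (return true)  true  = 0≤1
    0≤ℙ (return true)  false = ≤-refl
    0≤ℙ (return false) true  = ≤-refl
    0≤ℙ (return false) false = 0≤1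
    0≤ℙ (query e k)    a     = +-nonNegative
      (*-nonNegative (0≤answerProbability e true) (0≤ℙ (k true) a))
      (*-nonNegative (0≤answerProbability e false) (0≤ℙ (k false) a))

    ∑ℙ≈1 : ∀ m → ℙ m true + ℙ m false ≈ 1#
    ∑ℙ≈1 (return true)  = +-identityʳ 1#
    ∑ℙ≈1 (return false) = +-identityˡ 1#
    ∑ℙ≈1 (query e k)    = begin-equality
      α * P true + β * Q true + (α * P false + β * Q false)
        ≈⟨ solve 6 (λ α β a b c d → α :* a :+ β :* b :+ (α :* c :+ β :* d)
                                  := α :* (a :+ c) :+ β :* (b :+ d))
             refl α β (P true) (Q true) (P false) (Q false) ⟩
      α * (P true + P false) + β * (Q true + Q false)
        ≈⟨ +-cong (*-congˡ (∑ℙ≈1 (k true))) (*-congˡ (∑ℙ≈1 (k false))) ⟩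
      α * 1# + β * 1#
        ≈⟨ +-cong (*-identityʳ α) (*-identityʳ β) ⟩
      α + β
        ≈⟨ ∑answerProbability≈1 e ⟩
      1# ∎
      where
      α = answerProbability e true
      β = answerProbability e false
      P = ℙ (k true)
      Q = ℙ (k false)

    ℙ≤1 : ∀ m a → ℙ m a ≤ 1#
    ℙ≤1 m true  = ≤-trans (x≤y+x (0≤ℙ m false))
                    (≤-reflexive (trans (+-comm _ _) (∑ℙ≈1 m)))
    ℙ≤1 m false = ≤-trans (x≤y+x (0≤ℙ m true)) (≤-reflexive (∑ℙ≈1 m))

    complement-≤ : ∀ m {x} → ℙ m true ≤ x → 1# - x ≤ ℙ m false
    complement-≤ m {x} P≤x = +-cancelʳ-≤ x (begin
      1# - x + x            ≈⟨ x-y+y≈x 1# x ⟩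
      1#                    ≈⟨ ∑ℙ≈1 m ⟨
      ℙ m true + ℙ m false  ≤⟨ +-monoˡ-≤ (ℙ m false) P≤x ⟩
      x + ℙ m false         ≈⟨ +-comm x (ℙ m false) ⟩
      ℙ m false + x         ∎)

    complement-≤′ : ∀ m {x} → ℙ m false ≤ x → 1# - x ≤ ℙ m true
    complement-≤′ m {x} P≤x = +-cancelʳ-≤ x (begin
      1# - x + x            ≈⟨ x-y+y≈x 1# x ⟩
      1#                    ≈⟨ ∑ℙ≈1 m ⟨
      ℙ m true + ℙ m false  ≤⟨ +-monoʳ-≤ (ℙ m true) P≤x ⟩
      ℙ m true + x          ∎)

    -- The output probability of a composite is an average over the results of `m`, as the two
    -- answer probabilities of each query sum to 1.
    ℙ->>=-≤ : ∀ {A : Set} (m : OracleComp E A) {f a x} →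
      (∀ y → ℙ (f y) a ≤ x) → ℙ (m >>= f) a ≤ x
    ℙ->>=-≤ (return y)  f≤x = f≤x y
    ℙ->>=-≤ (query e k) {f} {a} {x} f≤x = begin
      ℙ (query e k >>= f) a   ≤⟨ ℙ-query-≤ e (λ b → k b >>= f)
                                   (ℙ->>=-≤ (k true) f≤x) (ℙ->>=-≤ (k false) f≤x) ⟩
      α * x + β * x           ≈⟨ distribʳ x α β ⟨
      (α + β) * x             ≈⟨ *-congʳ (∑answerProbability≈1 e) ⟩
      1# * x                  ≈⟨ *-identityˡ x ⟩
      x                       ∎
      where
      α = answerProbability e true
      β = answerProbability e false

    -- Error probabilities of the edge loops, by induction on the budget.

    module _ (c : ℕ) where
      open Counter c

      module _ {r} (0≤r : 0# ≤ r) (qr≈p : q * r ≈ p) where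

        -- r ^ d is a martingale on an unrealized edge.
        ℙ-true-processEdge-≤ : ∀ {e f} → realized e ≡ false → ℙ (f 0) true ≤ 0# →
          ∀ B d z → z ℤ.+ + d ≡ + c → ℙ (processEdge c e z B >>= f) true ≤ r ^ d
        -- `f0≤0` says that an exhausted budget never leads to True.
        ℙ-true-processEdge-≤ {e} {f} ¬real f0≤0 zero d z _ = ≤-trans f0≤0 (0≤x^n d 0≤r)
        ℙ-true-processEdge-≤ {e} {f} ¬real f0≤0 (suc B) zero z z+d≡c with z ℤ.<? + c
        -- At distance 0 the bound `r ^ 0` is 1.
        ... | no  _   = ℙ≤1 (f (suc B)) true
        ... | yes z<c = contradiction z<c (z≮c z z+d≡c)
        ℙ-true-processEdge-≤ {e} {f} ¬real f0≤0 (suc B) (suc d) z z+d≡c with z ℤ.<? + c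
        ... | no  z≮c = contradiction (z<c z d z+d≡c) z≮c
        ... | yes _   rewrite ¬real = begin
          p * ℙ (processEdge c e (z ℤ.+ 1ℤ) B >>= f) true +
          q * ℙ (processEdge c e (z ℤ.- 1ℤ) B >>= f) true
            ≤⟨ +-mono-≤
                 (*-monoʳ-≤ 0≤p
                   (ℙ-true-processEdge-≤ ¬real f0≤0 B d (z ℤ.+ 1ℤ) (up z d z+d≡c)))
                 (*-monoʳ-≤ 0≤1-p
                   (ℙ-true-processEdge-≤ ¬real f0≤0 B (suc (suc d)) (z ℤ.- 1ℤ) (down z d z+d≡c))) ⟩
          p * r ^ d + q * (r * (r * r ^ d))
            -- The martingale identity: `p + q r r = q r + p r = r`.
            ≈⟨ solve 4 (λ p q r x → p :* x :+ q :* (r :* (r :* x))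
                                  := (p :+ q :* r :* r) :* x) refl p q r (r ^ d) ⟩
          (p + q * r * r) * r ^ d
            ≈⟨ *-congʳ (+-cong (sym qr≈p) (*-congʳ qr≈p)) ⟩
          (q * r + p * r) * r ^ d
            ≈⟨ *-congʳ (distribʳ r q p) ⟨
          (q + p) * r * r ^ d
            ≈⟨ *-congʳ (trans (*-congʳ q+p≈1) (*-identityˡ r)) ⟩
          r * r ^ d ∎

        -- A single unrealized edge suffices: its loop starts at distance `c`, the edges after it
        -- are bounded trivially by 1, and the edges before it only average over the budgets with
        -- which it is reached.
        ℙ-true-processEdges-≤ : ∀ {e es} → realized e ≡ false → e ∈ es →
          ∀ B → ℙ (processEdges c es B) true ≤ r ^ c
        ℙ-true-processEdges-≤ ¬real (here ≡.refl) B =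
          ℙ-true-processEdge-≤ ¬real ≤-refl B c 0ℤ ≡.refl
        ℙ-true-processEdges-≤ {es = e′ ∷ es} ¬real (there e∈es) B =
          ℙ->>=-≤ (processEdge c e′ 0ℤ B)
            λ { zero    → 0≤x^n c 0≤r
              ; (suc B) → ℙ-true-processEdges-≤ ¬real e∈es (suc B) }

      -- `g` is the drift `q - p` of the counter on a realized edge; its reciprocal `μ` is the
      -- expected cost in queries of one unit of distance.
      module _ {g μ} (0≤μ : 0# ≤ μ) (q≈p+g : q ≈ p + g) (gμ≈1 : g * μ ≈ 1#)
               (connected : ∀ e → realized e ≡ true) where

        -- Markov's inequality for the number of queries, folded into the
        -- induction: d * μ bounds the expected number of queries on e.
        B*ℙ-false-processEdge-≤ : ∀ e {f K} → 0# ≤ K →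
          (∀ B → fromℕ B * ℙ (f B) false ≤ K) →
          ∀ B d z → z ℤ.+ + d ≡ + c →
          fromℕ B * ℙ (processEdge c e z B >>= f) false ≤ fromℕ d * μ + K
        B*ℙ-false-processEdge-≤ e {f} {K} 0≤K f≤K zero d z _ =
          ≤-trans (f≤K zero) (x≤y+x (*-nonNegative (0≤fromℕ d) 0≤μ))
        B*ℙ-false-processEdge-≤ e {f} {K} 0≤K f≤K (suc B) d z z+d≡c with z ℤ.<? + c
        ... | no  _   = ≤-trans (f≤K (suc B)) (x≤y+x (*-nonNegative (0≤fromℕ d) 0≤μ))
        B*ℙ-false-processEdge-≤ e {f} {K} 0≤K f≤K (suc B) zero z z+d≡c
            | yes z<c = contradiction z<c (z≮c z z+d≡c)
        B*ℙ-false-processEdge-≤ e {f} {K} 0≤K f≤K (suc B) (suc d) z z+d≡c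
            | yes _   rewrite connected e = begin
          (1# + β) * (q * P + p * Q)
            ≈⟨ solve 5 (λ β p q P Q → (con 1 :+ β) :* (q :* P :+ p :* Q)
                 := q :* (β :* P) :+ p :* (β :* Q) :+ (q :* P :+ p :* Q)) refl β p q P Q ⟩
          q * (β * P) + p * (β * Q) + (q * P + p * Q)
            -- Of the weight `1# + β`, the part `β` falls to the induction hypothesis after either
            -- answer. The part 1 accounts for the current query and uses only that probabilities
            -- are at most 1.
            ≤⟨ +-mono-≤
                 (+-mono-≤
                   (*-monoʳ-≤ 0≤1-p
                     (B*ℙ-false-processEdge-≤ e 0≤K f≤K B d (z ℤ.+ 1ℤ) (up z d z+d≡c)))
                   (*-monoʳ-≤ 0≤p
                     (B*ℙ-false-processEdge-≤ e 0≤K f≤K B (suc (suc d)) (z ℤ.- 1ℤ)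
                       (down z d z+d≡c))))
                 (+-mono-≤
                   (*-monoʳ-≤ 0≤1-p (ℙ≤1 (processEdge c e (z ℤ.+ 1ℤ) B >>= f) false))
                   (*-monoʳ-≤ 0≤p (ℙ≤1 (processEdge c e (z ℤ.- 1ℤ) B >>= f) false))) ⟩
          q * (D * μ + K) + p * ((1# + (1# + D)) * μ + K) + (q * 1# + p * 1#)
            ≈⟨ solve 5 (λ p q D μ K →
                 q :* (D :* μ :+ K) :+ p :* ((con 1 :+ (con 1 :+ D)) :* μ :+ K) :+
                 (q :* con 1 :+ p :* con 1)
                 := (q :+ p) :* (D :* μ :+ K :+ con 1) :+ (p :+ p) :* μ) refl p q D μ K ⟩
          (q + p) * (D * μ + K + 1#) + (p + p) * μ
            ≈⟨ +-congʳ (trans (*-congʳ q+p≈1) (*-identityˡ _)) ⟩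
          D * μ + K + 1# + (p + p) * μ
            -- The expected distance drops by `g`, from `D + 1` to `D + 2 p`, so its multiple by `μ`
            -- drops by `g * μ = 1`, which pays for the query.
            ≈⟨ +-congʳ (+-congˡ gμ≈1) ⟨
          D * μ + K + g * μ + (p + p) * μ
            ≈⟨ solve 5 (λ p g D μ K → D :* μ :+ K :+ g :* μ :+ (p :+ p) :* μ
                 := (p :+ g :+ p :+ D) :* μ :+ K) refl p g D μ K ⟩
          (p + g + p + D) * μ + K
            ≈⟨ +-congʳ (*-congʳ (+-congʳ (trans (+-congʳ (sym q≈p+g)) q+p≈1))) ⟩
          (1# + D) * μ + K ∎
          where
          β = fromℕ B
          D = fromℕ d
          P = ℙ (processEdge c e (z ℤ.+ 1ℤ) B >>= f) false
          Q = ℙ (processEdge c e (z ℤ.- 1ℤ) B >>= f) false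

        B*ℙ-false-processEdges-≤ : ∀ es B →
          fromℕ B * ℙ (processEdges c es B) false ≤ fromℕ (length es) * (fromℕ c * μ)
        B*ℙ-false-processEdges-≤ []       B =
          ≤-reflexive (trans (zeroʳ (fromℕ B)) (sym (zeroˡ (fromℕ c * μ))))
        B*ℙ-false-processEdges-≤ (e ∷ es) B = begin
          fromℕ B * ℙ (processEdges c (e ∷ es) B) false
            ≤⟨ B*ℙ-false-processEdge-≤ e 0≤K
                 -- An exhausted budget does output False, but there the weight `fromℕ B` is 0.
                 (λ { zero    → ≤-trans (≤-reflexive (zeroˡ _)) 0≤K
                    ; (suc B) → B*ℙ-false-processEdges-≤ es (suc B) })
                 B c 0ℤ ≡.refl ⟩
          fromℕ c * μ + fromℕ (length es) * (fromℕ c * μ)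
            ≈⟨ solve 2 (λ x n → x :+ n :* x := (con 1 :+ n) :* x) refl _ _ ⟩
          (1# + fromℕ (length es)) * (fromℕ c * μ) ∎
          where
          0≤K = *-nonNegative (0≤fromℕ (length es)) (*-nonNegative (0≤fromℕ c) 0≤μ)

  -- The guarantees for the concrete threshold and budget.

  module Analysis (p : Carrier) (0<p : 0# < p) (p<1/2 : p < 1# / fromℕ 2) where
    open Algorithm R p

    private
      q = 1# - p
      g = 1# - fromℕ 2 * p
      b = q / p
      μ = 1# / g

    0<g : 0# < g
    0<g = ≰⇒> λ g≤0 → <⇒≱ p<1/2 (*-cancelʳ-≤ (0<fromℕ 1) (begin
      1# / fromℕ 2 * fromℕ 2 ≈⟨ x/y*y≈x (0<fromℕ 1) ⟩
      1#                     ≈⟨ x-y+y≈x 1# (fromℕ 2 * p) ⟨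
      g + fromℕ 2 * p        ≤⟨ +-monoˡ-≤ (fromℕ 2 * p) g≤0 ⟩
      0# + fromℕ 2 * p       ≈⟨ +-identityˡ (fromℕ 2 * p) ⟩
      fromℕ 2 * p            ≈⟨ *-comm (fromℕ 2) p ⟩
      p * fromℕ 2            ∎))

    q≈p+g : q ≈ p + g
    q≈p+g = +-cancelʳ p q (p + g) (begin-equality
      q + p           ≈⟨ x-y+y≈x 1# p ⟩
      1#              ≈⟨ x-y+y≈x 1# (fromℕ 2 * p) ⟨
      g + fromℕ 2 * p ≈⟨ solve 2 (λ g p → g :+ (con 1 :+ (con 1 :+ con 0)) :* p
                                   := p :+ g :+ p) refl g p ⟩
      p + g + p       ∎)

    0<μ : 0# < μ
    0<μ = *-positive 0<1 (⁻¹-positive 0<g)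

    gμ≈1 : g * μ ≈ 1#
    gμ≈1 = trans (*-comm g μ) (x/y*y≈x 0<g)

    1<b : 1# < b
    1<b = ≰⇒> λ b≤1 → <⇒≱ 0<g (+-cancelʳ-≤ p (begin
      g + p   ≈⟨ trans (+-comm g p) (sym q≈p+g) ⟩
      q       ≈⟨ x/y*y≈x 0<p ⟨
      b * p   ≤⟨ *-monoˡ-≤ (<⇒≤ 0<p) b≤1 ⟩
      1# * p  ≈⟨ trans (*-identityˡ p) (sym (+-identityˡ p)) ⟩
      0# + p  ∎))

    0<b : 0# < b
    0<b = <-≤-trans 0<1 (<⇒≤ 1<b)

    0≤q : 0# ≤ q
    0≤q = ≤-trans (+-nonNegative (<⇒≤ 0<p) (<⇒≤ 0<g)) (≤-reflexive (sym q≈p+g))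

    qb⁻¹≈p : q * b ⁻¹ ≈ p
    qb⁻¹≈p = begin-equality
      q * b ⁻¹     ≈⟨ *-congʳ (trans (*-comm p b) (x/y*y≈x 0<p)) ⟨
      p * b * b ⁻¹ ≈⟨ x*y*y⁻¹≈x 0<b ⟩
      p            ∎

    module _ {ε δ : Carrier} (0<δ : 0# < δ) (δ<1 : δ < 1#) where
      private
        c = threshold ε δ
        1≤1/δ = <⇒≤ (1<1/x 0<δ δ<1)

      1/δ≤bᶜ : 1# / δ ≤ b ^ c
      1/δ≤bᶜ = log≤c⇒x≤bᶜ 1<b 1≤1/δ c (⌈x⌉-upper (log b (1# / δ)))

      b⁻ᶜ≤δ : (b ⁻¹) ^ c ≤ δ
      b⁻ᶜ≤δ = *-cancelˡ-≤ (*-positive 0<1 (⁻¹-positive 0<δ)) (begin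
        1# / δ * (b ⁻¹) ^ c   ≤⟨ *-monoˡ-≤ (0≤x^n c (<⇒≤ (⁻¹-positive 0<b))) 1/δ≤bᶜ ⟩
        b ^ c * (b ⁻¹) ^ c    ≈⟨ ^-distrib-* b (b ⁻¹) c ⟨
        (b * b ⁻¹) ^ c      ≈⟨ ^-congˡ c (x*x⁻¹≈1 0<b) ⟩
        1# ^ c              ≈⟨ 1^n≈1 c ⟩
        1#                  ≈⟨ x/y*y≈x 0<δ ⟨
        1# / δ * δ          ∎)

      -- A zero threshold would give `1# / δ ≤ 1#`. Positivity allows the threshold to be cancelled
      -- in Markov's inequality.
      0<threshold : 0# < fromℕ c
      0<threshold with c | 1/δ≤bᶜ
      ... | zero  | 1/δ≤1 = contradiction 1/δ≤1 (<⇒≱ (1<1/x 0<δ δ<1))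
      ... | suc k | _     = 0<fromℕ k

      -- A change of base from `b` to 2. Minimality of the ceiling gives `b ^ (c - 1) < 1# / δ`;
      -- raising this to the power `suc s` bounds `2 ^ (c - 1)` by `(1# / δ) ^ suc s`.
      threshold≤ : ∀ s → fromℕ 2 ≤ b ^ suc s →
        fromℕ c ≤ 1# + log (fromℕ 2) (1# / δ) * fromℕ (suc s)
      threshold≤ s 2≤bˢ with c | ⌈x⌉-least (log b (1# / δ))
      ... | zero  | _     = +-nonNegative 0≤1
        (bᵏ≤xᵐ⇒k≤log*m 1<2 1≤1/δ 0 s (1≤x^n (suc s) 1≤1/δ))
      ... | suc k | least = +-monoʳ-≤ 1#
        (bᵏ≤xᵐ⇒k≤log*m 1<2 1≤1/δ k s (begin
          fromℕ 2 ^ k        ≤⟨ ^-monoˡ-≤ k (0≤fromℕ 2) 2≤bˢ ⟩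
          (b ^ suc s) ^ k    ≈⟨ ^-assocʳ b (suc s) k ⟩
          b ^ (suc s ℕ.* k)  ≡⟨ ≡.cong (b ^_) (ℕ.*-comm (suc s) k) ⟩
          b ^ (k ℕ.* suc s)  ≈⟨ ^-assocʳ b k (suc s) ⟨
          (b ^ k) ^ suc s    ≤⟨ ^-monoˡ-≤ (suc s) (0≤x^n k (<⇒≤ 0<b)) bᵏ≤1/δ ⟩
          (1# / δ) ^ suc s   ∎))
        where
        bᵏ≤1/δ : b ^ k ≤ 1# / δ
        bᵏ≤1/δ = <⇒≤ (≰⇒> (ℕ.<⇒≱ ℕ.≤-refl ∘ least ∘ x≤bᶜ⇒log≤c 1<b 1≤1/δ k))

      ℙ-disconnected : ∀ {n es} (realized : _ → Bool) → es ↭ allFin n →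
        (∃ λ e → realized e ≡ false) →
        1# - δ ≤ NoisyOracle.ℙ R p realized (𝒜 ε δ es) false
      ℙ-disconnected {n} {es} realized es↭ (e , ¬real) = complement-≤ (𝒜 ε δ es) (begin
        ℙ (𝒜 ε δ es) true  ≤⟨ ℙ-true-processEdges-≤ c (<⇒≤ (⁻¹-positive 0<b)) qb⁻¹≈p ¬real
                                (∈-resp-↭ (↭-sym es↭) (∈-allFin e)) (budget ε δ n) ⟩
        (b ⁻¹) ^ c         ≤⟨ b⁻ᶜ≤δ ⟩
        δ                  ∎)
        where
        open OracleBounds p (<⇒≤ 0<p) 0≤q realized
        open NoisyOracle R p realized

      fromℕ-budget : ∀ n →
        fromℕ (budget ε δ n) ≈ fromℕ ⌈ (1# / ε) * μ ⌉ * fromℕ c * fromℕ n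
      fromℕ-budget n = trans (×1-homo-* (M ℕ.* c) n) (*-congʳ (×1-homo-* M c))
        where
        M = ⌈ (1# / ε) * μ ⌉

      ℙ-connected : ∀ {n es} (realized : _ → Bool) → 0# < ε → es ↭ allFin n →
        (∀ e → realized e ≡ true) →
        1# - ε ≤ NoisyOracle.ℙ R p realized (𝒜 ε δ es) true
      ℙ-connected {n} {es} realized 0<ε es↭ real = complement-≤′ (𝒜 ε δ es)
        -- The bound is proved for the budget of `length es`, which equals `n` for a permutation of
        -- `allFin n`.
        (≡.subst (λ k → ℙ (processEdges c es (budget ε δ k)) false ≤ ε)
          (≡.trans (↭-length es↭) (length-tabulate _)) (ℙ-false≤ε es))
        where
        open OracleBounds p (<⇒≤ 0<p) 0≤q realized
        open NoisyOracle R p realized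

        ℙ-false≤ε : ∀ es → ℙ (processEdges c es (budget ε δ (length es))) false ≤ ε
        -- Without edges the budget is 0, but the output is True, so False has probability 0.
        ℙ-false≤ε []           = <⇒≤ 0<ε
        -- Markov's inequality: the budget is at least `X * (C * N)`, and the bound `N * (C * μ)` on
        -- the expected cost is the fraction `ε` of it.
        ℙ-false≤ε es@(_ ∷ es′) = *-cancelˡ-≤
          (*-positive 0<X (*-positive 0<threshold (0<fromℕ (length es′)))) (begin
            X * (C * N) * P
              ≤⟨ *-monoˡ-≤ (0≤ℙ (processEdges c es B) false)
                   (*-monoˡ-≤ (*-nonNegative (0≤fromℕ c) (0≤fromℕ (length es)))
                     (⌈x⌉-upper X)) ⟩
            fromℕ ⌈ X ⌉ * (C * N) * P
              ≈⟨ *-congʳ (*-assoc (fromℕ ⌈ X ⌉) C N) ⟨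
            fromℕ ⌈ X ⌉ * C * N * P
              ≈⟨ *-congʳ (fromℕ-budget (length es)) ⟨
            fromℕ B * P
              ≤⟨ B*ℙ-false-processEdges-≤ c (<⇒≤ 0<μ) q≈p+g gμ≈1 real es B ⟩
            N * (C * μ)
              ≈⟨ *-congˡ (*-congˡ (trans (*-congʳ (x/y*y≈x 0<ε)) (*-identityˡ μ))) ⟨
            N * (C * (1# / ε * ε * μ))
              ≈⟨ solve 5 (λ i ε μ C N → N :* (C :* (i :* ε :* μ))
                                      := i :* μ :* (C :* N) :* ε) refl (1# / ε) ε μ C N ⟩
            X * (C * N) * ε ∎)
          where
          X = (1# / ε) * μ
          C = fromℕ c
          N = fromℕ (length es)
          B = budget ε δ (length es)
          P = ℙ (processEdges c es B) false
          0<X : 0# < X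
          0<X = *-positive (*-positive 0<1 (⁻¹-positive 0<ε)) 0<μ

      -- The factor `1# + μ` covers the ceiling of `μ / ε`, `suc s` covers the change of base in the
      -- threshold, and `suc m` covers the 1 added by the ceiling of the logarithm.
      maxQueries≤ : ∀ {n} (es : List (Fin n)) → 0# < ε → ε < 1# →
        ∀ s m → fromℕ 2 ≤ b ^ suc s → fromℕ 2 ≤ (1# / δ) ^ suc m →
        fromℕ (maxQueries (𝒜 ε δ es)) ≤
          (1# + μ) * (fromℕ (suc m) + fromℕ (suc s)) *
          ((1# / ε) * fromℕ n * log (fromℕ 2) (1# / δ))
      maxQueries≤ {n} es 0<ε ε<1 s m 2≤bˢ 2≤1/δᵐ = begin
        fromℕ (maxQueries (𝒜 ε δ es))
          ≤⟨ fromℕ-mono-≤ (maxQueries-processEdges c es (budget ε δ n)) ⟩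
        fromℕ (budget ε δ n)
          ≈⟨ fromℕ-budget n ⟩
        fromℕ ⌈ (1# / ε) * μ ⌉ * fromℕ c * N
          ≤⟨ *-monoˡ-≤ (0≤fromℕ n)
               (*-mono-≤ (0≤fromℕ ⌈ (1# / ε) * μ ⌉) 0≤LM+LS ceil≤ threshold≤LM+LS) ⟩
        (1# / ε + 1# / ε * μ) * (L * M + L * S) * N
          ≈⟨ solve 6 (λ i μ L M S N → (i :+ i :* μ) :* (L :* M :+ L :* S) :* N
               := (con 1 :+ μ) :* (M :+ S) :* (i :* N :* L)) refl (1# / ε) μ L M S N ⟩
        (1# + μ) * (M + S) * ((1# / ε) * N * L) ∎
        where
        L = log (fromℕ 2) (1# / δ)
        M = fromℕ (suc m)
        S = fromℕ (suc s)
        N = fromℕ n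

        ceil≤ : fromℕ ⌈ (1# / ε) * μ ⌉ ≤ 1# / ε + 1# / ε * μ
        ceil≤ = ≤-trans
          (⌈x⌉≤1+x (<⇒≤ (*-positive (*-positive 0<1 (⁻¹-positive 0<ε)) 0<μ)))
          -- As `ε < 1#`, the 1 added by the ceiling is at most `1# / ε`.
          (+-monoˡ-≤ (1# / ε * μ) (<⇒≤ (1<1/x 0<ε ε<1)))

        1≤LM : 1# ≤ L * M
        1≤LM = ≤-trans (≤-reflexive (sym (+-identityʳ 1#)))
          (bᵏ≤xᵐ⇒k≤log*m 1<2 1≤1/δ 1 m
            (≤-trans (≤-reflexive (*-identityʳ (fromℕ 2))) 2≤1/δᵐ))

        threshold≤LM+LS : fromℕ c ≤ L * M + L * S
        threshold≤LM+LS = ≤-trans (threshold≤ s 2≤bˢ) (+-monoˡ-≤ (L * S) 1≤LM)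

        0≤LM+LS : 0# ≤ L * M + L * S
        0≤LM+LS = ≤-trans (0≤fromℕ c) threshold≤LM+LS

    -- The exponent `s` depends only on `b`, and `m` only on `δ₀`, so one constant serves all `ε`,
    -- `δ` and `n`. The choice of `m` carries over to smaller `δ` because `1# / δ` only grows.
    maxQueries-bound : ∀ δ₀ → 0# < δ₀ → δ₀ < 1# → ∃ λ C →
      ∀ ε δ → 0# < ε → ε < 1# → 0# < δ → δ ≤ δ₀ →
      ∀ n (es : List (Fin n)) →
      fromℕ (maxQueries (𝒜 ε δ es)) ≤ C * ((1# / ε) * fromℕ n * log (fromℕ 2) (1# / δ))
    maxQueries-bound δ₀ 0<δ₀ δ₀<1
      with s , 2≤bˢ ← powers-unbounded 1<b (fromℕ 2)
         | m , 2≤1/δ₀ᵐ ← powers-unbounded (1<1/x 0<δ₀ δ₀<1) (fromℕ 2) =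
      _ , λ ε δ 0<ε ε<1 0<δ δ≤δ₀ n es →
        maxQueries≤ 0<δ (≤-<-trans δ≤δ₀ δ₀<1) es 0<ε ε<1 s m 2≤bˢ
          (≤-trans 2≤1/δ₀ᵐ
            (^-monoˡ-≤ (suc m) (<⇒≤ (*-positive 0<1 (⁻¹-positive 0<δ₀))) (1/-antitone 0<δ δ≤δ₀)))
      where
      1/-antitone : ∀ {δ} → 0# < δ → δ ≤ δ₀ → 1# / δ₀ ≤ 1# / δ
      1/-antitone {δ} 0<δ δ≤δ₀ = x*z≤y⇒x≤y/z 0<δ (begin
        1# / δ₀ * δ   ≤⟨ *-monoʳ-≤ (<⇒≤ (*-positive 0<1 (⁻¹-positive 0<δ₀))) δ≤δ₀ ⟩
        1# / δ₀ * δ₀  ≈⟨ x/y*y≈x 0<δ₀ ⟩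
        1#            ∎)

theorem1 :
  (R : Reals) →
  let
    open Reals R
    open RealFunctions R
    open Algorithm R
    open NoisyOracle R
  in
  ∀ (p : Carrier) → 0# < p → p < 1# / fromℕ 2 →
  (∀ (ε δ : Carrier) → 0# < ε → ε < 1# → 0# < δ → δ < 1# →
   ∀ (n : ℕ) (T : Tree n) (realized : Tree.Edge T → Bool) →
   ∀ (es : List (Tree.Edge T)) → es ↭ allFin n →
     ((∀ e → realized e ≡ true) →
        1# - ε ≤ ℙ p realized (𝒜 p ε δ es) true)
     ×
     ((∃ λ e → realized e ≡ false) →
        1# - δ ≤ ℙ p realized (𝒜 p ε δ es) false))
  ×
  -- the threshold is at least 1 while log (1 / δ) tends
  -- to 0 as δ → 1, so the O is read for δ bounded away from 1
  (∀ (δ₀ : Carrier) → 0# < δ₀ → δ₀ < 1# →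
   ∃ λ (C : Carrier) →
   ∀ (ε δ : Carrier) → 0# < ε → ε < 1# → 0# < δ → δ ≤ δ₀ →
   ∀ (n : ℕ) (T : Tree n) (es : List (Tree.Edge T)) → es ↭ allFin n →
     fromℕ (maxQueries (𝒜 p ε δ es))
       ≤ C * ((1# / ε) * fromℕ n * log (fromℕ 2) (1# / δ)))
theorem1 R p 0<p p<1/2 =
  (λ ε δ 0<ε ε<1 0<δ δ<1 n T realized es es↭ →
    ℙ-connected 0<δ δ<1 realized 0<ε es↭ , ℙ-disconnected 0<δ δ<1 realized es↭) ,
  λ δ₀ 0<δ₀ δ₀<1 →
    let C , bound = maxQueries-bound δ₀ 0<δ₀ δ₀<1
    in C , λ ε δ 0<ε ε<1 0<δ δ≤δ₀ n T es es↭ → bound ε δ 0<ε ε<1 0<δ δ≤δ₀ n es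
  where
  open Analysis R p 0<p p<1/2
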